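{- There is an absolute constant $C>0$ such that for every pair of integers $k\ge 1$ and $n\ge k+2$, $$(n-1)(1+k/2) \;\le\; M_{n,k} \;\le\; n(1+k/2) + C k^2 .$$ Furthermore, if $n\equiv 1 \pmod{k+1}$, then $M_{n,k}=(n-1)(1+k/2)$.
   Context: All graphs are finite, simple and undirected. A $k$-truss is a graph with no isolated vertices in which every edge is contained in at least $k$ triangles. $M_{n,k}$ denotes the minimum number of edges of a connected $k$-truss on exactly $n$ vertices. -}

module Defs where

open import Data.Fin using (Fin; _<_)
open import Data.Fin.Properties using (_<?_)
open import Data.Integer using (+_)
open import Data.List using (List; length; filter; allFin; cartesianProduct)
open import Data.Nat as ℕ using (ℕ)
open import Data.Product using (_×_; _,_; ∃-syntax; uncurry)
open import Data.Rational using (ℚ)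
open import Data.Rational.Literals using (fromℤ)
open import Level using (0ℓ)
open import Relation.Binary using (Rel; Decidable; Symmetric)
open import Relation.Binary.Construct.Closure.ReflexiveTransitive using (Star)
open import Relation.Binary.PropositionalEquality using (_≡_)
open import Relation.Nullary using (Dec; ¬_)
open import Relation.Nullary.Decidable using (_×-dec_)

fromℕ : ℕ → ℚ
fromℕ n = fromℤ (+ n)

-- Adjacency is required to be decidable so that edges and triangles of the
-- (finite) graph can be counted.
record SimpleGraph (n : ℕ) : Set₁ where
  field
    Adj         : Rel (Fin n) 0ℓ
    adj?        : Decidable Adj
    symmetric   : Symmetric Adj
    irreflexive : ∀ u → ¬ Adj u u

  -- An unordered edge {u , v} is listed once, as the pair with u < v.
  edges : List (Fin n × Fin n)
  edges = filter (uncurry λ u v → (u <? v) ×-dec adj? u v)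
                 (cartesianProduct (allFin n) (allFin n))

  edgeCount : ℕ
  edgeCount = length edges

  Triangle : Fin n → Fin n → Fin n → Set
  Triangle u v w = Adj u v × Adj v w × Adj u w

  triangle? : ∀ u v w → Dec (Triangle u v w)
  triangle? u v w = adj? u v ×-dec adj? v w ×-dec adj? u w

  -- A triangle containing a given edge uv is determined by its third vertex,
  -- so the triangles containing uv are counted by counting third vertices.
  triangleCount : Fin n → Fin n → ℕ
  triangleCount u v = length (filter (triangle? u v) (allFin n))

  -- Existence of a walk between any two vertices.
  Connected : Set
  Connected = ∀ u v → Star Adj u v

  NoIsolatedVertices : Set
  NoIsolatedVertices = ∀ u → ∃[ v ] Adj u v

  IsTruss : ℕ → Set
  IsTruss k = NoIsolatedVertices × (∀ u v → Adj u v → k ℕ.≤ triangleCount u v)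

open SimpleGraph public

-- m is the number of edges of some connected k-truss on n vertices.
TrussSize : (n k m : ℕ) → Set₁
TrussSize n k m =
  ∃[ G ] Connected {n} G × IsTruss G k × edgeCount G ≡ m

-- M n,k is rendered as a relation: "IsM n k m" says that the minimum exists
-- and equals m (such an m is unique, by antisymmetry of ≤).
IsM : (n k m : ℕ) → Set₁
IsM n k m = TrussSize n k m × (∀ m′ → TrussSize n k m′ → m ℕ.≤ m′)

{-# OPTIONS --safe #-}
module Submission where

open import Defs
open import Data.Bool using (true; false; if_then_else_)
import Data.Bool.Properties as Bool
open import Data.Fin as Fin using (Fin; zero; suc; _↑ˡ_; _↑ʳ_; splitAt; join; combine)
open import Data.Fin.Properties as Finₚ using (_≟_; splitAt-join; join-splitAt; all?; any?)
open import Data.Fin.Subset using (Subset)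
open import Data.Fin.Subset.Properties using (anySubset?)
import Data.Integer as ℤ
import Data.Integer.Properties as ℤₚ
open import Data.List using (List; []; _∷_; _++_; map; length; filter; tabulate; allFin; cartesianProduct)
open import Data.List.Membership.Propositional using (_∈_)
open import Data.List.Membership.Propositional.Properties
  using (∈-filter⁺; ∈-filter⁻; ∈-cartesianProduct⁺; ∈-allFin)
open import Data.List.Properties using (length-++; filter-++; filter-≐)
open import Data.List.Relation.Unary.Any using (here; there)
open import Data.Nat as ℕ using (ℕ; zero; suc; _%_; z≤n; s≤s)
import Data.Nat.Properties as ℕₚ
open import Data.Nat.DivMod using (m≡m%n+[m/n]*n; m%n<n; [m+kn]%n≡m%n; m<n⇒m%n≡m; n%n≡0)
open import Data.Nat.Tactic.RingSolver using (solve-∀)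
open import Data.Product using (_×_; _,_; ∃; ∃-syntax; proj₁; proj₂; uncurry)
open import Data.Rational using (0ℚ; 1ℚ; ½; -_; *≤*; *<*)
import Data.Rational.Properties as ℚₚ
open import Data.Sum using (_⊎_; inj₁; inj₂; [_,_]′; swap)
open import Data.Unit using (tt)
import Data.Vec as Vec
open import Data.Vec.Properties using (lookup∘tabulate)
open import Function using (_∘_; id)
open import Relation.Binary using (Rel; Decidable; DecidableEquality; tri<; tri≈; tri>)
open import Relation.Binary.Construct.Closure.ReflexiveTransitive as Star using (Star; ε; _◅_; _◅◅_)
open import Relation.Binary.PropositionalEquality
open import Relation.Nullary using (Dec; yes; no; does; ¬_; contradiction)
open import Relation.Nullary.Decidable using (_×-dec_; _⊎-dec_; ¬?; map′; toSum; _→-dec_; dec-true)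
import Relation.Unary as U

-- Lower bound: root a connected k-truss on n vertices and let p be the parent of
-- v ≠ root on a geodesic to the root. The vertex v is adjacent to p, to at least
-- k common neighbours of v and p, and to its own children; the latter are at
-- distance 2 from p, so these are distinct neighbours. Hence v has degree at
-- least k + 1 + (number of children of v), and summing over v counts every
-- non-root once as a child: 2 m ≥ (n - 1) (k + 1) + (n - 1).
--
-- Upper bound: write n = q (k + 1) + s with k + 2 ≤ s ≤ 2 k + 2. Cliques, one
-- K_s and q copies of K_(k+2), that share a single vertex form a connected k-truss
-- with 2 m = q (k + 1) (k + 2) + s (s - 1), which is (n - 1) (k + 2) if s = k + 2
-- and at most n (k + 2) + 4 k² in general.

-- Indicator sums over finite types and the handshake identity.

module Counting where

  open import Algebra.Properties.Semiring.Sum ℕₚ.+-*-semiring public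
    using (sum; sum-syntax; sum-cong-≗; ∑-distrib-+; ∑-comm; *-distribʳ-sum)
  open import Data.Nat using (_+_; _*_; _≤_)

  -- The Iverson bracket, taken on `does` alone, so that decisions built with `map′`, such as
  -- `suc i ≟ suc j`, keep their value by computation.
  ⟦_⟧ : ∀ {p} {P : Set p} → Dec P → ℕ
  ⟦ p? ⟧ = if does p? then 1 else 0

  ⟦⟧-mono : ∀ {p q} {P : Set p} {Q : Set q} (p? : Dec P) (q? : Dec Q) →
            (P → Q) → ⟦ p? ⟧ ≤ ⟦ q? ⟧
  ⟦⟧-mono (no _)  _        _ = z≤n
  ⟦⟧-mono (yes _) (yes _)  _ = s≤s z≤n
  ⟦⟧-mono (yes p) (no ¬q)  f = contradiction (f p) ¬q

  ⟦⟧-cong : ∀ {p q} {P : Set p} {Q : Set q} (p? : Dec P) (q? : Dec Q) →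
            (P → Q) → (Q → P) → ⟦ p? ⟧ ≡ ⟦ q? ⟧
  ⟦⟧-cong p? q? f g = ℕₚ.≤-antisym (⟦⟧-mono p? q? f) (⟦⟧-mono q? p? g)

  ⟦⟧-disjoint : ∀ {p q r} {P : Set p} {Q : Set q} {R : Set r}
                (p? : Dec P) (q? : Dec Q) (r? : Dec R) →
                (P → R) → (Q → R) → ¬ (P × Q) → ⟦ p? ⟧ + ⟦ q? ⟧ ≤ ⟦ r? ⟧
  ⟦⟧-disjoint (no _)  q?      r? _ g _ = ⟦⟧-mono q? r? g
  ⟦⟧-disjoint (yes p) (yes q) r? _ _ d = contradiction (p , q) d
  ⟦⟧-disjoint p?@(yes _) (no _) r? f _ _ = ⟦⟧-mono p? r? f

  ⟦⟧-cover : ∀ {p q r} {P : Set p} {Q : Set q} {R : Set r}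
             (p? : Dec P) (q? : Dec Q) (r? : Dec R) →
             (R → P ⊎ Q) → ⟦ r? ⟧ ≤ ⟦ p? ⟧ + ⟦ q? ⟧
  ⟦⟧-cover _       _       (no _)  _ = z≤n
  ⟦⟧-cover (yes _) _       (yes _) _ = s≤s z≤n
  ⟦⟧-cover (no _)  (yes _) (yes _) _ = s≤s z≤n
  ⟦⟧-cover (no ¬p) (no ¬q) (yes r) f = contradiction (f r) [ ¬p , ¬q ]′

  ⟦⟧-partition : ∀ {p q r} {P : Set p} {Q : Set q} {R : Set r}
                 (p? : Dec P) (q? : Dec Q) (r? : Dec R) →
                 (R → P ⊎ Q) → (P → R) → (Q → R) → ¬ (P × Q) →
                 ⟦ r? ⟧ ≡ ⟦ p? ⟧ + ⟦ q? ⟧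
  ⟦⟧-partition p? q? r? c f g d =
    ℕₚ.≤-antisym (⟦⟧-cover p? q? r? c) (⟦⟧-disjoint p? q? r? f g d)

  ∑-mono : ∀ {n} {f g : Fin n → ℕ} → (∀ i → f i ≤ g i) → sum f ≤ sum g
  ∑-mono {zero}  _   = z≤n
  ∑-mono {suc n} f≤g = ℕₚ.+-mono-≤ (f≤g zero) (∑-mono (f≤g ∘ suc))

  ∑-const : ∀ n c → ∑[ i < n ] c ≡ n * c
  ∑-const zero    c = refl
  ∑-const (suc n) c = cong (c +_) (∑-const n c)

  ∑-splitAt : ∀ a {n} (f : Fin (a + n) → ℕ) →
              sum f ≡ ∑[ i < a ] f (i ↑ˡ n) + ∑[ x < n ] f (a ↑ʳ x)
  ∑-splitAt zero    f = refl
  ∑-splitAt (suc a) f =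
    trans (cong (f zero +_) (∑-splitAt a (f ∘ suc))) (sym (ℕₚ.+-assoc (f zero) _ _))

  ∑-≟ : ∀ {n} (j : Fin n) → ∑[ i < n ] ⟦ i ≟ j ⟧ ≡ 1
  ∑-≟ {suc n} zero    = cong suc (trans (∑-const n 0) (ℕₚ.*-zeroʳ n))
  ∑-≟ {suc n} (suc j) = ∑-≟ j

  ∑-≢ : ∀ {n} (j : Fin (suc n)) → ∑[ i < suc n ] ⟦ ¬? (i ≟ j) ⟧ ≡ n
  ∑-≢ {n} j = ℕₚ.+-cancelʳ-≡ 1 _ n (begin
    sum ≢j + 1                          ≡⟨ cong (sum ≢j +_) (∑-≟ j) ⟨
    sum ≢j + ∑[ i < suc n ] ⟦ i ≟ j ⟧   ≡⟨ ∑-distrib-+ ≢j (λ i → ⟦ i ≟ j ⟧) ⟨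
    ∑[ i < suc n ] (≢j i + ⟦ i ≟ j ⟧)   ≡⟨ sum-cong-≗ (λ i → ⟦⟧-partition (¬? (i ≟ j)) (i ≟ j) (yes tt)
                                                    (λ _ → swap (toSum (i ≟ j))) _ _ (λ (i≢j , i≡j) → i≢j i≡j)) ⟨
    ∑[ i < suc n ] 1                    ≡⟨ ∑-const (suc n) 1 ⟩
    suc n * 1                           ≡⟨ ℕₚ.*-identityʳ (suc n) ⟩
    suc n                               ≡⟨ ℕₚ.+-comm 1 n ⟩
    n + 1                               ∎)
    where
    open ≡-Reasoning
    ≢j : Fin (suc n) → ℕ
    ≢j i = ⟦ ¬? (i ≟ j) ⟧

  -- Of the `n` indices other than `j`, excluding `l` as well loses at most one. The `+ 1` avoids
  -- subtraction and also covers `j ≡ l`.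
  ∑-≢≢ : ∀ {n} (j l : Fin (suc n)) →
         n ≤ ∑[ i < suc n ] ⟦ ¬? (i ≟ j) ×-dec ¬? (i ≟ l) ⟧ + 1
  ∑-≢≢ {n} j l = begin
    n                                               ≡⟨ ∑-≢ j ⟨
    ∑[ i < suc n ] ⟦ ¬? (i ≟ j) ⟧                   ≤⟨ ∑-mono (λ i → ⟦⟧-cover (≢? i) (i ≟ l) (¬? (i ≟ j)) (cover i)) ⟩
    ∑[ i < suc n ] (⟦ ≢? i ⟧ + ⟦ i ≟ l ⟧)           ≡⟨ ∑-distrib-+ (λ i → ⟦ ≢? i ⟧) (λ i → ⟦ i ≟ l ⟧) ⟩
    ∑[ i < suc n ] ⟦ ≢? i ⟧ + ∑[ i < suc n ] ⟦ i ≟ l ⟧ ≡⟨ cong (sum (λ i → ⟦ ≢? i ⟧) +_) (∑-≟ l) ⟩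
    ∑[ i < suc n ] ⟦ ≢? i ⟧ + 1                     ∎
    where
    open ℕₚ.≤-Reasoning
    ≢? : ∀ i → Dec (i ≢ j × i ≢ l)
    ≢? i = ¬? (i ≟ j) ×-dec ¬? (i ≟ l)
    cover : ∀ i → i ≢ j → (i ≢ j × i ≢ l) ⊎ i ≡ l
    cover i i≢j with i ≟ l
    ... | yes i≡l = inj₂ i≡l
    ... | no  i≢l = inj₁ (i≢j , i≢l)

  -- Turns counts defined as lengths of filtered lists into indicator sums, which can be regrouped
  -- and interchanged.
  length-filter-tabulate : ∀ {a p} {A : Set a} {P : A → Set p} (P? : U.Decidable P) {n} (f : Fin n → A) →
                           length (filter P? (tabulate f)) ≡ ∑[ i < n ] ⟦ P? (f i) ⟧
  length-filter-tabulate P? {zero}  f = refl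
  length-filter-tabulate P? {suc n} f with does (P? (f zero))
  ... | true  = cong suc (length-filter-tabulate P? (f ∘ suc))
  ... | false = length-filter-tabulate P? (f ∘ suc)

  length-filter-map : ∀ {a b p} {A : Set a} {B : Set b} {P : B → Set p} (P? : U.Decidable P)
                      (f : A → B) xs → length (filter P? (map f xs)) ≡ length (filter (P? ∘ f) xs)
  length-filter-map P? f []       = refl
  length-filter-map P? f (x ∷ xs) with does (P? (f x))
  ... | true  = cong suc (length-filter-map P? f xs)
  ... | false = length-filter-map P? f xs

  length-filter-cartesianProduct :
    ∀ {a p} {A : Set a} {P : A × A → Set p} (P? : U.Decidable P) {m n} (f : Fin m → A) (g : Fin n → A) →
    length (filter P? (cartesianProduct (tabulate f) (tabulate g)))
      ≡ ∑[ i < m ] ∑[ j < n ] ⟦ P? (f i , g j) ⟧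
  length-filter-cartesianProduct P? {zero}      f g = refl
  length-filter-cartesianProduct P? {suc m} {n} f g = begin
    length (filter P? (row ++ rows))                       ≡⟨ cong length (filter-++ P? row rows) ⟩
    length (filter P? row ++ filter P? rows)               ≡⟨ length-++ (filter P? row) ⟩
    length (filter P? row) + length (filter P? rows)       ≡⟨ cong₂ _+_ first (length-filter-cartesianProduct P? (f ∘ suc) g) ⟩
    _ ∎
    where
    open ≡-Reasoning
    row rows : List _
    row  = map (f zero ,_) (tabulate g)
    rows = cartesianProduct (tabulate (f ∘ suc)) (tabulate g)
    first : length (filter P? row) ≡ ∑[ j < n ] ⟦ P? (f zero , g j) ⟧
    first = trans (length-filter-map P? (f zero ,_) (tabulate g)) (length-filter-tabulate _ g)

  module _ {n} (G : SimpleGraph n) where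

    degree : Fin n → ℕ
    degree u = ∑[ v < n ] ⟦ adj? G u v ⟧

    triangleCount-∑ : ∀ u v → triangleCount G u v ≡ ∑[ w < n ] ⟦ triangle? G u v w ⟧
    triangleCount-∑ u v = length-filter-tabulate (triangle? G u v) id

    -- Edges are listed in increasing order. Transposing the double sum counts them in decreasing
    -- order, and by irreflexivity the two orders partition the adjacent pairs.
    handshake : 2 * edgeCount G ≡ sum degree
    handshake = begin
      2 * edgeCount G                                            ≡⟨ cong (edgeCount G +_) (ℕₚ.+-identityʳ _) ⟩
      edgeCount G + edgeCount G                                  ≡⟨ cong₂ _+_ up down ⟩
      ∑[ u < n ] ∑[ v < n ] ⟦ up? u v ⟧ + ∑[ u < n ] ∑[ v < n ] ⟦ down? u v ⟧
        ≡⟨ ∑-distrib-+ (λ u → ∑[ v < n ] ⟦ up? u v ⟧) _ ⟨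
      ∑[ u < n ] (∑[ v < n ] ⟦ up? u v ⟧ + ∑[ v < n ] ⟦ down? u v ⟧)
        ≡⟨ sum-cong-≗ (λ u → trans (sym (∑-distrib-+ (λ v → ⟦ up? u v ⟧) _)) (sum-cong-≗ (split u))) ⟩
      sum degree                                                 ∎
      where
      open ≡-Reasoning
      up? : ∀ u v → Dec (u Fin.< v × Adj G u v)
      up? u v = (u Finₚ.<? v) ×-dec adj? G u v
      down? : ∀ u v → Dec (v Fin.< u × Adj G u v)
      down? u v = (v Finₚ.<? u) ×-dec adj? G u v
      up : edgeCount G ≡ ∑[ u < n ] ∑[ v < n ] ⟦ up? u v ⟧
      up = length-filter-cartesianProduct (uncurry up?) {n} {n} id id
      down : edgeCount G ≡ ∑[ u < n ] ∑[ v < n ] ⟦ down? u v ⟧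
      down = trans up (trans (∑-comm (λ u v → ⟦ up? u v ⟧)) (sum-cong-≗ λ v → sum-cong-≗ λ u →
        ⟦⟧-cong (up? u v) (down? v u) (λ (l , e) → l , symmetric G e) (λ (l , e) → l , symmetric G e)))
      split : ∀ u v → ⟦ up? u v ⟧ + ⟦ down? u v ⟧ ≡ ⟦ adj? G u v ⟧
      split u v = sym (⟦⟧-partition (up? u v) (down? u v) (adj? G u v) orient proj₂ proj₂
                         (λ ((u<v , _) , (v<u , _)) → ℕₚ.<-asym u<v v<u))
        where
        orient : Adj G u v → (u Fin.< v × Adj G u v) ⊎ (v Fin.< u × Adj G u v)
        orient e with Finₚ.<-cmp u v
        ... | tri< u<v _ _ = inj₁ (u<v , e)
        ... | tri≈ _ refl _ = contradiction e (irreflexive G u)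
        ... | tri> _ _ v<u = inj₂ (v<u , e)

-- Decidability of truss sizes and existence of the minimum.

module Minimisation where

  open import Data.Nat using (_*_; _≤_)

  -- Induction on the known witness `b`: unless `0` qualifies, the predicate is shifted by one and
  -- the witness drops by one.
  least : ∀ {p} {P : ℕ → Set p} → U.Decidable P → ∀ b → P b → ∃[ m ] P m × (∀ j → P j → m ≤ j)
  least P? zero    Pb = 0 , Pb , λ _ _ → z≤n
  least P? (suc b) Pb with P? 0
  ... | yes P0 = 0 , P0 , λ _ _ → z≤n
  ... | no ¬P0 with least (P? ∘ suc) b Pb
  ...   | m , Pm , minimal =
    suc m , Pm , λ { zero P0 → contradiction P0 ¬P0 ; (suc j) Pj → s≤s (minimal j Pj) }

  Star-∈? : ∀ {a} {A : Set a} → DecidableEquality A → (arcs : List (A × A)) →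
            Decidable (Star (λ u v → (u , v) ∈ arcs))
  Star-∈? _≟ₐ_ []               u v = map′ (λ { refl → ε }) (λ { ε → refl }) (u ≟ₐ v)
  Star-∈? _≟ₐ_ ((a , b) ∷ arcs) u v =
    map′ [ Star.map there , (λ (p , q) → Star.map there p ◅◅ here refl ◅ Star.map there q) ]′ lastUse
         (Star-∈? _≟ₐ_ arcs u v ⊎-dec (Star-∈? _≟ₐ_ arcs u a ×-dec Star-∈? _≟ₐ_ arcs b v))
    where
    -- Keeps the stretch before the first use of `(a , b)` and the stretch after its last use;
    -- everything between them is dropped.
    lastUse : ∀ {u v} → Star (λ u v → (u , v) ∈ (a , b) ∷ arcs) u v →
              Star (λ u v → (u , v) ∈ arcs) u v ⊎
              Star (λ u v → (u , v) ∈ arcs) u a × Star (λ u v → (u , v) ∈ arcs) b v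
    lastUse ε = inj₁ ε
    lastUse (here refl ◅ ps) = inj₂ (ε , [ id , proj₂ ]′ (lastUse ps))
    lastUse (there e ◅ ps) with lastUse ps
    ... | inj₁ qs        = inj₁ (e ◅ qs)
    ... | inj₂ (qs , rs) = inj₂ (e ◅ qs , rs)

  module _ {n} (G : SimpleGraph n) where

    connected? : Dec (Connected G)
    connected? = all? λ u → all? λ v →
      map′ (Star.map (λ e → proj₂ (∈-filter⁻ arc? {xs = pairs} e)))
           (Star.map (λ e → ∈-filter⁺ arc? (∈-cartesianProduct⁺ (∈-allFin _) (∈-allFin _)) e))
           (Star-∈? _≟_ (filter arc? pairs) u v)
      where
      arc? : U.Decidable (uncurry (Adj G))
      arc? = uncurry (adj? G)
      pairs : List (Fin n × Fin n)
      pairs = cartesianProduct (allFin n) (allFin n)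

    isTruss? : ∀ k → Dec (IsTruss G k)
    isTruss? k = (all? λ u → any? (adj? G u)) ×-dec
                 (all? λ u → all? λ v → adj? G u v →-dec (k ℕ.≤? triangleCount G u v))

    hasSize? : ∀ k m → Dec (Connected G × IsTruss G k × edgeCount G ≡ m)
    hasSize? k m = connected? ×-dec isTruss? k ×-dec (edgeCount G ℕ.≟ m)

  module _ {n} (G H : SimpleGraph n)
           (to : ∀ {u v} → Adj G u v → Adj H u v) (from : ∀ {u v} → Adj H u v → Adj G u v) where

    private
      edgeCount-≐ : edgeCount G ≡ edgeCount H
      edgeCount-≐ = cong length (filter-≐ _ _ ((λ (l , e) → l , to e) , (λ (l , e) → l , from e))
                                          (cartesianProduct (allFin n) (allFin n)))

      triangleCount-≐ : ∀ u v → triangleCount G u v ≡ triangleCount H u v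
      triangleCount-≐ u v = cong length (filter-≐ (triangle? G u v) (triangle? H u v)
        ((λ (p , q , r) → to p , to q , to r) , (λ (p , q , r) → from p , from q , from r)) (allFin n))

    -- Logical equivalence of the adjacencies suffices, since edges and triangles are counted by
    -- filtering the same lists. This lets a graph be replaced by its encoding as a set of arcs.
    hasSize-≐ : ∀ {k m} → Connected G × IsTruss G k × edgeCount G ≡ m →
                          Connected H × IsTruss H k × edgeCount H ≡ m
    hasSize-≐ {k} (conn , (noIsolated , triangles) , size) =
      (λ u v → Star.map to (conn u v)) ,
      ((λ u → let v , e = noIsolated u in v , to e) ,
       (λ u v e → subst (k ≤_) (triangleCount-≐ u v) (triangles u v (from e)))) ,
      trans (sym edgeCount-≐) size

  -- Symmetrising and removing loops makes every subset of the n² arcs a graph,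
  -- so the graphs on n vertices can be searched through exhaustively.
  fromArcs : ∀ {n} → Subset (n * n) → SimpleGraph n
  fromArcs S = record
    { Adj         = λ u v → u ≢ v × (Arc u v ⊎ Arc v u)
    ; adj?        = λ u v → ¬? (u ≟ v) ×-dec (arc? u v ⊎-dec arc? v u)
    ; symmetric   = λ (u≢v , e) → u≢v ∘ sym , swap e
    ; irreflexive = λ _ (u≢u , _) → u≢u refl
    }
    where
    Arc : Rel (Fin _) _
    Arc u v = Vec.lookup S (combine u v) ≡ true
    arc? : Decidable Arc
    arc? u v = Vec.lookup S (combine u v) Bool.≟ true

  module _ {n} (G : SimpleGraph n) where

    toArcs : Subset (n * n)
    toArcs = Vec.tabulate (λ i → does (uncurry (adj? G) (Fin.remQuot n i)))

    lookup-toArcs : ∀ u v → Vec.lookup toArcs (combine u v) ≡ does (adj? G u v)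
    lookup-toArcs u v = trans (lookup∘tabulate _ (combine u v))
                              (cong (does ∘ uncurry (adj? G)) (Finₚ.remQuot-combine u v))

    Adj⇒arc : ∀ {u v} → Adj G u v → Adj (fromArcs toArcs) u v
    Adj⇒arc {u} {v} e = (λ { refl → irreflexive G u e }) ,
                        inj₁ (trans (lookup-toArcs u v) (dec-true (adj? G u v) e))

    arc⇒Adj : ∀ {u v} → Adj (fromArcs toArcs) u v → Adj G u v
    arc⇒Adj (_ , e) = [ true⇒Adj , symmetric G ∘ true⇒Adj ]′ e
      where
      true⇒Adj : ∀ {u v} → Vec.lookup toArcs (combine u v) ≡ true → Adj G u v
      true⇒Adj {u} {v} eq with adj? G u v | trans (sym (lookup-toArcs u v)) eq
      ... | yes e | _ = e

  -- Every graph is equivalent to `fromArcs` of its own arc set, so the quantifier over graphs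
  -- becomes a search through finitely many subsets.
  trussSize? : ∀ n k m → Dec (TrussSize n k m)
  trussSize? n k m =
    map′ (λ (S , h) → fromArcs S , h)
         (λ (G , h) → toArcs G , hasSize-≐ G (fromArcs (toArcs G)) (Adj⇒arc G) (arc⇒Adj G) h)
         (anySubset? (λ S → hasSize? (fromArcs S) k m))

  -- A single truss gives the starting point for `least`, so any construction also proves that the
  -- minimum exists.
  minimum : ∀ {n k m} → TrussSize n k m → ∃ (IsM n k)
  minimum {n} {k} {m} = least (trussSize? n k) m

-- Lower bound: distances, parents and children, degree counting.

module LowerBound where

  open Counting
  open Minimisation using (least)
  open import Data.Nat using (_+_; _*_; _≤_)

  module _ {n} (G : SimpleGraph n) where

    -- Indexed by length, unlike `Star`: each length is decidable, so `least` can find the distance.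
    Walk : ℕ → Rel (Fin n) _
    Walk zero    u v = u ≡ v
    Walk (suc l) u v = ∃[ w ] Adj G u w × Walk l w v

    walk? : ∀ l → Decidable (Walk l)
    walk? zero    u v = u ≟ v
    walk? (suc l) u v = any? λ w → adj? G u w ×-dec walk? l w v

    Star⇒Walk : ∀ {u v} → Star (Adj G) u v → ∃[ l ] Walk l u v
    Star⇒Walk ε        = 0 , refl
    Star⇒Walk (e ◅ es) = let l , ws = Star⇒Walk es in suc l , _ , e , ws

  module _ {N k} (G : SimpleGraph (suc N)) (connected : Connected G)
           (triangles : ∀ u v → Adj G u v → k ≤ triangleCount G u v) where

    root : Fin (suc N)
    root = zero

    geodesic : ∀ u → ∃[ l ] Walk G l u root × (∀ j → Walk G j u root → l ≤ j)
    geodesic u = let l , ws = Star⇒Walk G (connected u root) in least (λ j → walk? G j u root) l ws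

    dist : Fin (suc N) → ℕ
    dist u = proj₁ (geodesic u)

    dist-adj : ∀ {u v} → Adj G u v → dist u ≤ suc (dist v)
    dist-adj {u} {v} e = proj₂ (proj₂ (geodesic u)) _ (v , e , proj₁ (proj₂ (geodesic v)))

    closerNeighbour : ∀ u → u ≢ root → ∃[ p ] Adj G u p × dist u ≡ suc (dist p)
    closerNeighbour u u≢root = firstStep (dist u) refl (proj₁ (proj₂ (geodesic u)))
      where
      -- The length is a variable tied to `dist u` by an equation, so that the geodesic can be split
      -- into its first edge and the rest.
      firstStep : ∀ l → dist u ≡ l → Walk G l u root → ∃[ p ] Adj G u p × dist u ≡ suc (dist p)
      firstStep zero    _  u≡root       = contradiction u≡root u≢root
      firstStep (suc l) eq (p , e , ws) =
        p , e , ℕₚ.≤-antisym (dist-adj e)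
                  (ℕₚ.≤-trans (s≤s (proj₂ (proj₂ (geodesic p)) l ws)) (ℕₚ.≤-reflexive (sym eq)))

    -- The value at the root is junk.
    parent : Fin (suc N) → Fin (suc N)
    parent u with u ≟ root
    ... | yes _     = root
    ... | no u≢root = proj₁ (closerNeighbour u u≢root)

    parent-closer : ∀ u → u ≢ root → Adj G u (parent u) × dist u ≡ suc (dist (parent u))
    parent-closer u u≢root with u ≟ root
    ... | yes u≡root = contradiction u≡root u≢root
    ... | no  u≢root = proj₂ (closerNeighbour u u≢root)

    Child : Rel (Fin (suc N)) _
    Child v w = w ≢ root × parent w ≡ v

    child? : Decidable Child
    child? v w = ¬? (w ≟ root) ×-dec (parent w ≟ v)

    children : Fin (suc N) → ℕ
    children v = ∑[ w < suc N ] ⟦ child? v w ⟧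

    Child⇒Adj : ∀ {v w} → Child v w → Adj G v w
    Child⇒Adj {w = w} (w≢root , refl) = symmetric G (proj₁ (parent-closer w w≢root))

    -- Weaker than the bound for non-roots, but it also holds at the root, which has no parent.
    children≤degree : ∀ v → children v ≤ degree G v
    children≤degree v = ∑-mono λ w → ⟦⟧-mono (child? v w) (adj? G v w) Child⇒Adj

    -- The parent p of v and the k common neighbours of v and p are within
    -- distance 1 of p, whereas the children of v are at distance 2 from p.
    k+1+children≤degree : ∀ v → v ≢ root → suc k + children v ≤ degree G v
    k+1+children≤degree v v≢root = begin
      suc k + children v                                  ≡⟨ cong (_+ children v) (ℕₚ.+-comm 1 k) ⟩
      k + 1 + children v                                  ≤⟨ ℕₚ.+-monoˡ-≤ _ (ℕₚ.+-mono-≤ (triangles v p v∼p) (ℕₚ.≤-reflexive (sym (∑-≟ p)))) ⟩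
      triangleCount G v p + ∑[ w < suc N ] ⟦ w ≟ p ⟧ + children v
        ≡⟨ cong (λ t → t + ∑[ w < suc N ] ⟦ w ≟ p ⟧ + children v) (triangleCount-∑ G v p) ⟩
      ∑[ w < suc N ] ⟦ tri? w ⟧ + ∑[ w < suc N ] ⟦ w ≟ p ⟧ + children v
        ≡⟨ cong (_+ children v) (∑-distrib-+ (λ w → ⟦ tri? w ⟧) (λ w → ⟦ w ≟ p ⟧)) ⟨
      ∑[ w < suc N ] (⟦ tri? w ⟧ + ⟦ w ≟ p ⟧) + children v
        ≤⟨ ℕₚ.+-monoˡ-≤ _ (∑-mono λ w → ⟦⟧-disjoint (tri? w) (w ≟ p) (near? w) inj₁ inj₂
             λ { ((_ , e , _) , refl) → irreflexive G p e }) ⟩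
      ∑[ w < suc N ] ⟦ near? w ⟧ + children v
        ≡⟨ ∑-distrib-+ (λ w → ⟦ near? w ⟧) (λ w → ⟦ child? v w ⟧) ⟨
      ∑[ w < suc N ] (⟦ near? w ⟧ + ⟦ child? v w ⟧)
        ≤⟨ (∑-mono λ w → ⟦⟧-disjoint (near? w) (child? v w) (adj? G v w) near⇒Adj Child⇒Adj
             λ (near , child) → ℕₚ.<⇒≱ (child-far child) (near-dist near)) ⟩
      degree G v                                          ∎
      where
      open ℕₚ.≤-Reasoning
      p = parent v
      v∼p : Adj G v p
      v∼p = proj₁ (parent-closer v v≢root)
      tri? : ∀ w → Dec (Triangle G v p w)
      tri? = triangle? G v p
      near? : ∀ w → Dec (Triangle G v p w ⊎ w ≡ p)
      near? w = tri? w ⊎-dec (w ≟ p)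
      near⇒Adj : ∀ {w} → Triangle G v p w ⊎ w ≡ p → Adj G v w
      near⇒Adj = [ proj₂ ∘ proj₂ , (λ { refl → v∼p }) ]′
      near-dist : ∀ {w} → Triangle G v p w ⊎ w ≡ p → dist w ≤ suc (dist p)
      near-dist (inj₁ (_ , e , _)) = dist-adj (symmetric G e)
      near-dist (inj₂ refl)        = ℕₚ.n≤1+n _
      child-far : ∀ {w} → Child v w → suc (dist p) ℕ.< dist w
      child-far {w} (w≢root , refl) = ℕₚ.≤-reflexive
        (sym (trans (proj₂ (parent-closer w w≢root)) (cong suc (proj₂ (parent-closer v v≢root)))))

    -- Double counting of parent-child pairs: each of the `N` non-roots is a child of its parent.
    N≤∑children : N ≤ ∑[ v < suc N ] children v
    N≤∑children = begin
      N                                              ≡⟨ ∑-≢ root ⟨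
      ∑[ w < suc N ] ⟦ ¬? (w ≟ root) ⟧               ≤⟨ ∑-mono hasParent ⟩
      ∑[ w < suc N ] ∑[ v < suc N ] ⟦ child? v w ⟧   ≡⟨ ∑-comm (λ v w → ⟦ child? v w ⟧) ⟨
      ∑[ v < suc N ] children v                      ∎
      where
      open ℕₚ.≤-Reasoning
      hasParent : ∀ w → ⟦ ¬? (w ≟ root) ⟧ ≤ ∑[ v < suc N ] ⟦ child? v w ⟧
      hasParent w = byCases (w ≟ root)
        where
        -- The decision is a separate argument, so that `parent w` and `child? v w`, which depend on
        -- it too, stay untouched.
        byCases : (w≟root : Dec (w ≡ root)) → ⟦ ¬? w≟root ⟧ ≤ ∑[ v < suc N ] ⟦ child? v w ⟧
        byCases (yes _)     = z≤n
        byCases (no w≢root) = ℕₚ.≤-trans (ℕₚ.≤-reflexive (sym (∑-≟ (parent w))))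
          (∑-mono λ v → ⟦⟧-mono (v ≟ parent w) (child? v w) λ v≡p → w≢root , sym v≡p)

    N*[2+k]≤2*edgeCount : N * (2 + k) ≤ 2 * edgeCount G
    N*[2+k]≤2*edgeCount = begin
      N * (2 + k)                                         ≡⟨ ℕₚ.*-suc N (suc k) ⟩
      N + N * suc k                                       ≡⟨ ℕₚ.+-comm N _ ⟩
      N * suc k + N                                       ≤⟨ ℕₚ.+-monoʳ-≤ _ N≤∑children ⟩
      -- `N` is now read as the number of non-roots, which charges `suc k` to each of them and
      -- allows a comparison with the degrees vertex by vertex.
      N * suc k + sum children                            ≡⟨ cong (λ m → m * suc k + sum children) (∑-≢ root) ⟨
      sum nonRoot * suc k + sum children                  ≡⟨ cong (_+ sum children) (*-distribʳ-sum (suc k) nonRoot) ⟩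
      ∑[ v < suc N ] (nonRoot v * suc k) + sum children   ≡⟨ ∑-distrib-+ (λ v → nonRoot v * suc k) children ⟨
      ∑[ v < suc N ] (nonRoot v * suc k + children v)     ≤⟨ ∑-mono degreeBound ⟩
      sum (degree G)                                      ≡⟨ handshake G ⟨
      2 * edgeCount G                                     ∎
      where
      open ℕₚ.≤-Reasoning
      nonRoot : Fin (suc N) → ℕ
      nonRoot v = ⟦ ¬? (v ≟ root) ⟧
      degreeBound : ∀ v → nonRoot v * suc k + children v ≤ degree G v
      degreeBound v with v ≟ root
      ... | yes _     = children≤degree v
      ... | no v≢root = subst (λ m → m + children v ≤ degree G v) (sym (ℕₚ.+-identityʳ (suc k)))
                              (k+1+children≤degree v v≢root)

  truss-lowerBound : ∀ {N k m} → TrussSize (suc N) k m → N * (2 + k) ≤ 2 * m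
  truss-lowerBound (G , connected , (_ , triangles) , refl) =
    N*[2+k]≤2*edgeCount G connected triangles

-- Construction: cliques glued at a vertex.

module Construction where

  open Counting
  open import Data.Nat using (_+_; _*_; _≤_)

  complete : ∀ n → SimpleGraph n
  complete n = record
    { Adj         = λ u v → v ≢ u
    ; adj?        = λ u v → ¬? (v ≟ u)
    ; symmetric   = λ v≢u → v≢u ∘ sym
    ; irreflexive = λ _ u≢u → u≢u refl
    }

  complete-truss : ∀ {k t} → k ≤ t → ∃[ m ] TrussSize (2 + t) k m × 2 * m ≡ (2 + t) * (1 + t)
  complete-truss {k} {t} k≤t =
    edgeCount G , (G , connected , (noIsolated , triangles) , refl) , (begin
      2 * edgeCount G           ≡⟨ handshake G ⟩
      sum (degree G)            ≡⟨ sum-cong-≗ (∑-≢ {suc t}) ⟩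
      ∑[ u < 2 + t ] (1 + t)    ≡⟨ ∑-const (2 + t) (1 + t) ⟩
      (2 + t) * (1 + t)         ∎)
    where
    open ≡-Reasoning
    G = complete (2 + t)
    connected : Connected G
    connected u v with v ≟ u
    ... | yes refl = ε
    ... | no  v≢u  = v≢u ◅ ε
    noIsolated : NoIsolatedVertices G
    noIsolated zero    = suc zero , λ ()
    noIsolated (suc _) = zero , λ ()
    triangles : ∀ u v → Adj G u v → k ≤ triangleCount G u v
    -- Any vertex other than `u` and `v` completes a triangle; `∑-≢≢` bounds `1 + t` by their number
    -- plus one, and the ones cancel.
    triangles u v v≢u = ℕₚ.≤-trans k≤t (ℕₚ.+-cancelʳ-≤ 1 t _ (ℕₚ.≤-trans
      (ℕₚ.≤-reflexive (ℕₚ.+-comm t 1))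
      (ℕₚ.≤-trans (∑-≢≢ v u) (ℕₚ.+-monoˡ-≤ 1 (ℕₚ.≤-trans
        (∑-mono λ w → ⟦⟧-mono (¬? (w ≟ v) ×-dec ¬? (w ≟ u)) (triangle? G u v w) (v≢u ,_))
        (ℕₚ.≤-reflexive (sym (triangleCount-∑ G u v))))))))

  -- a new vertices that form a complete graph together with the vertex h of G.
  module Attach (a : ℕ) {n} (G : SimpleGraph n) (h : Fin n) where

    -- Stated on the sum type, so that proofs split into new and old vertices; `splitAt` carries it
    -- over to `Fin (a + n)`.
    AdjS : Rel (Fin a ⊎ Fin n) _
    AdjS (inj₁ i) (inj₁ j) = j ≢ i
    AdjS (inj₁ i) (inj₂ y) = y ≡ h
    AdjS (inj₂ x) (inj₁ j) = x ≡ h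
    AdjS (inj₂ x) (inj₂ y) = Adj G x y

    adjS? : Decidable AdjS
    adjS? (inj₁ i) (inj₁ j) = ¬? (j ≟ i)
    adjS? (inj₁ i) (inj₂ y) = y ≟ h
    adjS? (inj₂ x) (inj₁ j) = x ≟ h
    adjS? (inj₂ x) (inj₂ y) = adj? G x y

    symmetricS : ∀ s t → AdjS s t → AdjS t s
    symmetricS (inj₁ i) (inj₁ j) e = e ∘ sym
    symmetricS (inj₁ i) (inj₂ y) e = e
    symmetricS (inj₂ x) (inj₁ j) e = e
    symmetricS (inj₂ x) (inj₂ y) e = symmetric G e

    irreflexiveS : ∀ s → ¬ AdjS s s
    irreflexiveS (inj₁ i) e = e refl
    irreflexiveS (inj₂ x) e = irreflexive G x e

    attach : SimpleGraph (a + n)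
    attach = record
      { Adj         = λ u v → AdjS (splitAt a u) (splitAt a v)
      ; adj?        = λ u v → adjS? (splitAt a u) (splitAt a v)
      ; symmetric   = λ {u} {v} → symmetricS (splitAt a u) (splitAt a v)
      ; irreflexive = λ u → irreflexiveS (splitAt a u)
      }

    vertex : Fin a ⊎ Fin n → Fin (a + n)
    vertex = join a n

    vertex-elim : ∀ {p} (P : Fin (a + n) → Set p) → (∀ s → P (vertex s)) → ∀ u → P u
    vertex-elim P P-vertex u = subst P (join-splitAt a n u) (P-vertex (splitAt a u))

    adj-vertex : ∀ s t → Adj attach (vertex s) (vertex t) ≡ AdjS s t
    adj-vertex s t = cong₂ AdjS (splitAt-join a n s) (splitAt-join a n t)

    AdjS⇒Adj : ∀ s t → AdjS s t → Adj attach (vertex s) (vertex t)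
    AdjS⇒Adj s t = subst id (sym (adj-vertex s t))

    ⟦adj-vertex⟧ : ∀ s t → ⟦ adj? attach (vertex s) (vertex t) ⟧ ≡ ⟦ adjS? s t ⟧
    ⟦adj-vertex⟧ s t = cong₂ (λ s t → ⟦ adjS? s t ⟧) (splitAt-join a n s) (splitAt-join a n t)

    -- Every vertex reaches the hub `h`: a new one by a single edge, an old one inside `G`. Two such
    -- walks are joined at `h`, the second reversed.
    attach-connected : Connected G → Connected attach
    attach-connected connected u v = toHub u ◅◅ Star.reverse (symmetric attach) (toHub v)
      where
      toHub : ∀ u → Star (Adj attach) u (vertex (inj₂ h))
      toHub = vertex-elim _ λ
        { (inj₁ i) → AdjS⇒Adj (inj₁ i) (inj₂ h) refl ◅ ε
        ; (inj₂ x) → Star.gmap (vertex ∘ inj₂) (AdjS⇒Adj (inj₂ _) (inj₂ _)) (connected x h)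
        }

    attach-noIsolated : NoIsolatedVertices G → NoIsolatedVertices attach
    attach-noIsolated noIsolated = vertex-elim _ λ
      { (inj₁ i) → _ , AdjS⇒Adj (inj₁ i) (inj₂ h) refl
      ; (inj₂ x) → let y , e = noIsolated x in _ , AdjS⇒Adj (inj₂ x) (inj₂ y) e
      }

    degree-vertex : ∀ s → degree attach (vertex s) ≡
                    ∑[ j < a ] ⟦ adjS? s (inj₁ j) ⟧ + ∑[ y < n ] ⟦ adjS? s (inj₂ y) ⟧
    degree-vertex s = trans (∑-splitAt a (λ v → ⟦ adj? attach (vertex s) v ⟧))
      (cong₂ _+_ (sum-cong-≗ (⟦adj-vertex⟧ s ∘ inj₁)) (sum-cong-≗ (⟦adj-vertex⟧ s ∘ inj₂)))

    triangleS? : ∀ s t r → Dec (AdjS s t × AdjS t r × AdjS s r)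
    triangleS? s t r = adjS? s t ×-dec adjS? t r ×-dec adjS? s r

    triangleCount-vertex : ∀ s t → triangleCount attach (vertex s) (vertex t) ≡
      ∑[ i < a ] ⟦ triangleS? s t (inj₁ i) ⟧ + ∑[ x < n ] ⟦ triangleS? s t (inj₂ x) ⟧
    triangleCount-vertex s t = begin
      triangleCount attach (vertex s) (vertex t)  ≡⟨ triangleCount-∑ attach (vertex s) (vertex t) ⟩
      ∑[ w < a + n ] ⟦ triangle? attach (vertex s) (vertex t) w ⟧
        ≡⟨ ∑-splitAt a (λ w → ⟦ triangle? attach (vertex s) (vertex t) w ⟧) ⟩
      _ ≡⟨ cong₂ _+_ (sum-cong-≗ (split ∘ inj₁)) (sum-cong-≗ (split ∘ inj₂)) ⟩
      _ ∎
      where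
      open ≡-Reasoning
      split : ∀ r → ⟦ triangle? attach (vertex s) (vertex t) (vertex r) ⟧ ≡ ⟦ triangleS? s t r ⟧
      split r rewrite splitAt-join a n s | splitAt-join a n t | splitAt-join a n r = refl

  module _ {k n : ℕ} (G : SimpleGraph n) (h : Fin n) where

    open Attach (suc k) G h

    -- The `suc k` new vertices and the hub form a clique on `k + 2` vertices, and old edges keep
    -- the triangles that they have in `G`.
    attach-triangles : (∀ u v → Adj G u v → k ≤ triangleCount G u v) →
                       ∀ u v → Adj attach u v → k ≤ triangleCount attach u v
    attach-triangles triangles = vertex-elim _ λ s → vertex-elim _ λ t e →
      subst (k ≤_) (sym (triangleCount-vertex s t)) (count s t (subst id (adj-vertex s t) e))
      where
      count : ∀ s t → AdjS s t →
              k ≤ ∑[ i < suc k ] ⟦ triangleS? s t (inj₁ i) ⟧ + ∑[ x < n ] ⟦ triangleS? s t (inj₂ x) ⟧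
      -- The hub, as a third vertex, makes up for the `1` lost in `∑-≢≢`.
      count s@(inj₁ i) t@(inj₁ j) j≢i = ℕₚ.≤-trans (∑-≢≢ j i) (ℕₚ.+-mono-≤
        (∑-mono λ l → ⟦⟧-mono (¬? (l ≟ j) ×-dec ¬? (l ≟ i)) (triangleS? s t (inj₁ l)) (j≢i ,_))
        (ℕₚ.≤-trans (ℕₚ.≤-reflexive (sym (∑-≟ h)))
          (∑-mono λ x → ⟦⟧-mono (x ≟ h) (triangleS? s t (inj₂ x)) λ x≡h → j≢i , x≡h , x≡h)))
      count s@(inj₁ i) t@(inj₂ y) y≡h = ℕₚ.m≤n⇒m≤n+o _ (ℕₚ.≤-trans (ℕₚ.≤-reflexive (sym (∑-≢ i)))
        (∑-mono λ l → ⟦⟧-mono (¬? (l ≟ i)) (triangleS? s t (inj₁ l)) λ l≢i → y≡h , y≡h , l≢i))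
      count s@(inj₂ x) t@(inj₁ j) x≡h = ℕₚ.m≤n⇒m≤n+o _ (ℕₚ.≤-trans (ℕₚ.≤-reflexive (sym (∑-≢ j)))
        (∑-mono λ l → ⟦⟧-mono (¬? (l ≟ j)) (triangleS? s t (inj₁ l)) λ l≢j → x≡h , l≢j , x≡h))
      count (inj₂ x) (inj₂ y) e = ℕₚ.m≤n⇒m≤o+n _
        (ℕₚ.≤-trans (triangles x y e) (ℕₚ.≤-reflexive (triangleCount-∑ G x y)))

    -- Each of the `suc k` new vertices has degree `k + 1`, the hub gains `suc k`, and all other
    -- degrees are unchanged.
    attach-edgeCount : 2 * edgeCount attach ≡ suc k * (2 + k) + 2 * edgeCount G
    attach-edgeCount = begin
      2 * edgeCount attach     ≡⟨ handshake attach ⟩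
      sum (degree attach)      ≡⟨ ∑-splitAt (suc k) (degree attach) ⟩
      ∑[ i < suc k ] degree attach (vertex (inj₁ i)) + ∑[ x < n ] degree attach (vertex (inj₂ x))
        ≡⟨ cong₂ _+_ (sum-cong-≗ newDegree) (sum-cong-≗ (degree-vertex ∘ inj₂)) ⟩
      ∑[ i < suc k ] (k + 1) + ∑[ x < n ] (∑[ j < suc k ] ⟦ x ≟ h ⟧ + degree G x)
        ≡⟨ cong₂ _+_ (∑-const (suc k) (k + 1)) (∑-distrib-+ (λ x → ∑[ j < suc k ] ⟦ x ≟ h ⟧) (degree G)) ⟩
      suc k * (k + 1) + (∑[ x < n ] ∑[ j < suc k ] ⟦ x ≟ h ⟧ + sum (degree G))
        ≡⟨ cong₂ (λ l m → suc k * (k + 1) + (l + m)) hubDegree (sym (handshake G)) ⟩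
      suc k * (k + 1) + (suc k * 1 + 2 * edgeCount G)
        ≡⟨ arithmetic k (2 * edgeCount G) ⟩
      suc k * (2 + k) + 2 * edgeCount G ∎
      where
      open ≡-Reasoning
      newDegree : ∀ i → degree attach (vertex (inj₁ i)) ≡ k + 1
      newDegree i = trans (degree-vertex (inj₁ i)) (cong₂ _+_ (∑-≢ i) (∑-≟ h))
      hubDegree : ∑[ x < n ] ∑[ j < suc k ] ⟦ x ≟ h ⟧ ≡ suc k * 1
      hubDegree = trans (∑-comm {n} {suc k} (λ x _ → ⟦ x ≟ h ⟧))
                        (trans (sum-cong-≗ {suc k} (λ _ → ∑-≟ h)) (∑-const (suc k) 1))
      arithmetic : ∀ k m → suc k * (k + 1) + (suc k * 1 + m) ≡ suc k * (2 + k) + m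
      arithmetic = solve-∀

    attach-truss : ∀ {m} → Connected G × IsTruss G k × edgeCount G ≡ m →
                   ∃[ m′ ] TrussSize (suc k + n) k m′ × 2 * m′ ≡ suc k * (2 + k) + 2 * m
    attach-truss (connected , (noIsolated , triangles) , refl) =
      edgeCount attach ,
      (attach , attach-connected connected , (attach-noIsolated noIsolated , attach-triangles triangles) , refl) ,
      attach-edgeCount

  blocks-truss : ∀ {k t} q → k ≤ t → ∃[ m ] TrussSize (q * suc k + (2 + t)) k m ×
                 2 * m ≡ q * (suc k * (2 + k)) + (2 + t) * (1 + t)
  blocks-truss zero    k≤t = complete-truss k≤t
  blocks-truss {k} {t} (suc q) k≤t =
    let m  , (G , G-truss) , eq  = blocks-truss q k≤t
        -- The hub is the first vertex of the clique on `2 + t` vertices. New vertices are placed in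
        -- front, so it is the same vertex at every stage.
        m′ , truss         , eq′ = attach-truss G (q * suc k ↑ʳ zero) G-truss
    in m′ ,
       subst (λ n → TrussSize n k m′) (sym (ℕₚ.+-assoc (suc k) (q * suc k) (2 + t))) truss ,
       trans eq′ (trans (cong (suc k * (2 + k) +_) eq) (sym (ℕₚ.+-assoc (suc k * (2 + k)) _ _)))

-- Block sizes and the bounds in doubled, integral form.

module Extremal where

  open LowerBound using (truss-lowerBound)
  open Minimisation using (minimum)
  open Construction using (blocks-truss)
  open import Data.Nat using (_+_; _*_; _∸_; _/_; _≤_; _<_)

  -- Division of `n ∸ (k + 2)` by `suc k`; setting `k + 2` aside first guarantees that the last
  -- clique has at least `k + 2` vertices.
  decompose : ∀ k n → k + 2 ≤ n → ∃[ q ] ∃[ r ] r ≤ k × n ≡ q * suc k + (2 + (k + r))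
  decompose k n k+2≤n = d / suc k , d % suc k , ℕ.s≤s⁻¹ (m%n<n d (suc k)) , (begin
    n                                        ≡⟨ ℕₚ.m+[n∸m]≡n k+2≤n ⟨
    k + 2 + d                                ≡⟨ cong (k + 2 +_) (m≡m%n+[m/n]*n d (suc k)) ⟩
    k + 2 + (d % suc k + d / suc k * suc k)  ≡⟨ rearrange k (d % suc k) (d / suc k * suc k) ⟩
    d / suc k * suc k + (2 + (k + d % suc k)) ∎)
    where
    open ≡-Reasoning
    d = n ∸ (k + 2)
    rearrange : ∀ k r s → k + 2 + (r + s) ≡ s + (2 + (k + r))
    rearrange = solve-∀

  -- Modulo `suc k` the vertex count is `suc r`, a number from `1` to `suc k`. Since `1 ≤ k`, the
  -- required residue is `1`, whereas `r ≡ k` would give `0`.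
  r≡0 : ∀ {k} q {r} → 1 ≤ k → r ≤ k → (q * suc k + (2 + (k + r))) % suc k ≡ 1 % suc k → r ≡ 0
  r≡0 {k} q {r} 1≤k r≤k eq = [ below , top ]′ (ℕₚ.m≤n⇒m<n∨m≡n r≤k)
    where
    rearrange : ∀ k q r → q * suc k + (2 + (k + r)) ≡ suc r + suc q * suc k
    rearrange = solve-∀
    residue : suc r % suc k ≡ 1
    residue = trans (sym ([m+kn]%n≡m%n (suc r) (suc q) (suc k)))
                    (trans (cong (_% suc k) (sym (rearrange k q r))) (trans eq (m<n⇒m%n≡m (s≤s 1≤k))))
    below : r < k → r ≡ 0
    below r<k = ℕₚ.suc-injective (trans (sym (m<n⇒m%n≡m (s≤s r<k))) residue)
    top : r ≡ k → r ≡ 0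
    top refl = contradiction (trans (sym (n%n≡0 (suc k))) residue) λ ()

  -- For a clique on `s = 2 + (k + r)` vertices, `s - 1` exceeds `k + 2` by `r - 1`. The case
  -- `r = 0` is separate because there is no excess.
  lastBlock-upperBound : ∀ {k r} → 1 ≤ k → r ≤ k →
    (2 + (k + r)) * (1 + (k + r)) ≤ (2 + (k + r)) * (2 + k) + 2 * (2 * (k * k))
  lastBlock-upperBound {k} {zero} _ _ = ℕₚ.m≤n⇒m≤n+o _
    (ℕₚ.*-monoʳ-≤ (2 + (k + 0)) (s≤s (ℕₚ.≤-trans (ℕₚ.≤-reflexive (ℕₚ.+-identityʳ k)) (ℕₚ.n≤1+n k))))
  lastBlock-upperBound {k} {suc r} 1≤k r<k = begin
    (2 + (k + suc r)) * (1 + (k + suc r))                           ≡⟨ expand k r ⟩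
    (2 + (k + suc r)) * (2 + k) + (1 + 1 + (k + suc r)) * r
      -- Each summand of `1 + 1 + (k + suc r)` is at most `k`, so the clique has at most `4 k`
      -- vertices and the excess is at most `4 k * k`.
      ≤⟨ ℕₚ.+-monoʳ-≤ _ (ℕₚ.*-mono-≤ (ℕₚ.+-mono-≤ (ℕₚ.+-mono-≤ 1≤k 1≤k) (ℕₚ.+-monoʳ-≤ k r<k)) (ℕₚ.<⇒≤ r<k)) ⟩
    (2 + (k + suc r)) * (2 + k) + (k + k + (k + k)) * k             ≡⟨ cong ((2 + (k + suc r)) * (2 + k) +_) (collect k) ⟩
    (2 + (k + suc r)) * (2 + k) + 2 * (2 * (k * k))                 ∎
    where
    open ℕₚ.≤-Reasoning
    expand : ∀ k r → (2 + (k + suc r)) * (1 + (k + suc r)) ≡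
                     (2 + (k + suc r)) * (2 + k) + (1 + 1 + (k + suc r)) * r
    expand = solve-∀
    collect : ∀ k → (k + k + (k + k)) * k ≡ 2 * (2 * (k * k))
    collect = solve-∀

  blocks-upperBound : ∀ {k} q {r} → 1 ≤ k → r ≤ k →
    q * (suc k * (2 + k)) + (2 + (k + r)) * (1 + (k + r)) ≤
    (q * suc k + (2 + (k + r))) * (2 + k) + 2 * (2 * (k * k))
  blocks-upperBound {k} q {r} 1≤k r≤k = begin
    q * (suc k * (2 + k)) + (2 + (k + r)) * (1 + (k + r))
      ≤⟨ ℕₚ.+-monoʳ-≤ _ (lastBlock-upperBound 1≤k r≤k) ⟩
    q * (suc k * (2 + k)) + ((2 + (k + r)) * (2 + k) + 2 * (2 * (k * k)))
      ≡⟨ collect k q r (2 * (2 * (k * k))) ⟩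
    (q * suc k + (2 + (k + r))) * (2 + k) + 2 * (2 * (k * k)) ∎
    where
    open ℕₚ.≤-Reasoning
    collect : ∀ k q r s → q * (suc k * (2 + k)) + ((2 + (k + r)) * (2 + k) + s) ≡
                          (q * suc k + (2 + (k + r))) * (2 + k) + s
    collect = solve-∀

  -- With `r = 0` there are `q + 1` cliques on `k + 2` vertices, and outside the shared vertex they
  -- have `(q + 1) (k + 1)` vertices.
  blocks-exact : ∀ k q → q * (suc k * (2 + k)) + (2 + (k + 0)) * (1 + (k + 0)) ≡
                         (q * suc k + (2 + (k + 0)) ∸ 1) * (2 + k)
  blocks-exact k q = begin
    q * (suc k * (2 + k)) + (2 + (k + 0)) * (1 + (k + 0))   ≡⟨ collect k q ⟩
    (q * suc k + (1 + (k + 0))) * (2 + k)                   ≡⟨ cong (λ N → (N ∸ 1) * (2 + k)) (ℕₚ.+-suc (q * suc k) (1 + (k + 0))) ⟨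
    (q * suc k + (2 + (k + 0)) ∸ 1) * (2 + k)               ∎
    where
    open ≡-Reasoning
    collect : ∀ k q → q * (suc k * (2 + k)) + (2 + (k + 0)) * (1 + (k + 0)) ≡
                      (q * suc k + (1 + (k + 0))) * (2 + k)
    collect = solve-∀

  -- The bounds are doubled and `n` is `suc N`, so neither fractions nor subtraction occur. The
  -- minimum `m` is compared with the size `m₀` of the glued cliques.
  M-bounds : ∀ k N → 1 ≤ k → k + 2 ≤ suc N →
    ∃[ m ] IsM (suc N) k m
      × N * (2 + k) ≤ 2 * m
      × 2 * m ≤ suc N * (2 + k) + 2 * (2 * (k * k))
      × (suc N % suc k ≡ 1 % suc k → 2 * m ≡ N * (2 + k))
  M-bounds k N 1≤k k+2≤n with decompose k (suc N) k+2≤n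
  ... | q , r , r≤k , n≡ with blocks-truss q (ℕₚ.m≤m+n k r)
  ...   | m₀ , truss₀ , 2m₀≡ with minimum (subst (λ n → TrussSize n k m₀) (sym n≡) truss₀)
  ...     | m , truss , minimal = m , (truss , minimal) , lower , upper , exact
    where
    lower : N * (2 + k) ≤ 2 * m
    lower = truss-lowerBound truss
    2m≤2m₀ : 2 * m ≤ 2 * m₀
    2m≤2m₀ = ℕₚ.*-monoʳ-≤ 2 (minimal m₀ (subst (λ n → TrussSize n k m₀) (sym n≡) truss₀))
    upper : 2 * m ≤ suc N * (2 + k) + 2 * (2 * (k * k))
    upper = ℕₚ.≤-trans 2m≤2m₀ (subst₂ (λ s n → s ≤ n * (2 + k) + 2 * (2 * (k * k)))
      (sym 2m₀≡) (sym n≡) (blocks-upperBound q 1≤k r≤k))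
    exact : suc N % suc k ≡ 1 % suc k → 2 * m ≡ N * (2 + k)
    exact n%≡1 = ℕₚ.≤-antisym (ℕₚ.≤-trans 2m≤2m₀ (ℕₚ.≤-reflexive 2m₀≡N*[2+k])) lower
      where
      r-zero : r ≡ 0
      r-zero = r≡0 q 1≤k r≤k (trans (cong (_% suc k) (sym n≡)) n%≡1)
      2m₀≡N*[2+k] : 2 * m₀ ≡ N * (2 + k)
      2m₀≡N*[2+k] = trans 2m₀≡ (trans
        (cong (λ r → q * (suc k * (2 + k)) + (2 + (k + r)) * (1 + (k + r))) r-zero)
        (trans (blocks-exact k q) (cong (λ n → (n ∸ 1) * (2 + k))
          (sym (trans n≡ (cong (λ r → q * suc k + (2 + (k + r))) r-zero))))))

-- Passage to rational numbers.

open Extremal using (M-bounds)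
open import Data.Integer using (+_)
open import Data.Rational using (_+_; _-_; _*_; _/_; _≤_; _<_)

-- Both sides are brought to the form `_ / 1`: the left by `fromℚᵘ-toℚᵘ`, the right because a
-- rational sum unfolds to a quotient, here with denominator `1`.
fromℕ-homo-+ : ∀ a b → fromℕ (a ℕ.+ b) ≡ fromℕ a + fromℕ b
fromℕ-homo-+ a b = trans (sym (ℚₚ.fromℚᵘ-toℚᵘ (fromℕ (a ℕ.+ b))))
  (cong (_/ 1) (sym (cong₂ ℤ._+_ (ℤₚ.*-identityʳ (+ a)) (ℤₚ.*-identityʳ (+ b)))))

fromℕ-homo-* : ∀ a b → fromℕ (a ℕ.* b) ≡ fromℕ a * fromℕ b
fromℕ-homo-* a b = trans (sym (ℚₚ.fromℚᵘ-toℚᵘ (fromℕ (a ℕ.* b)))) (cong (_/ 1) (ℤₚ.pos-* a b))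

fromℕ-mono-≤ : ∀ {a b} → a ℕ.≤ b → fromℕ a ≤ fromℕ b
fromℕ-mono-≤ a≤b = *≤* (ℤₚ.*-monoʳ-≤-nonNeg (+ 1) (ℤ.+≤+ a≤b))

fromℕ-pred : ∀ n → fromℕ (suc n) - 1ℚ ≡ fromℕ n
fromℕ-pred n = begin
  fromℕ (suc n) - 1ℚ       ≡⟨ cong (_- 1ℚ) (trans (cong fromℕ (ℕₚ.+-comm 1 n)) (fromℕ-homo-+ n 1)) ⟩
  fromℕ n + 1ℚ - 1ℚ        ≡⟨ ℚₚ.+-assoc (fromℕ n) 1ℚ (- 1ℚ) ⟩
  fromℕ n + (1ℚ - 1ℚ)      ≡⟨ ℚₚ.+-identityʳ (fromℕ n) ⟩
  fromℕ n                  ∎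
  where open ≡-Reasoning

fromℕ-halve : ∀ a → fromℕ a ≡ fromℕ (2 ℕ.* a) * ½
fromℕ-halve a = begin
  fromℕ a                  ≡⟨ ℚₚ.*-identityʳ (fromℕ a) ⟨
  fromℕ a * (fromℕ 2 * ½)  ≡⟨ ℚₚ.*-assoc (fromℕ a) (fromℕ 2) ½ ⟨
  fromℕ a * fromℕ 2 * ½    ≡⟨ cong (_* ½) (fromℕ-homo-* a 2) ⟨
  fromℕ (a ℕ.* 2) * ½      ≡⟨ cong (λ b → fromℕ b * ½) (ℕₚ.*-comm a 2) ⟩
  fromℕ (2 ℕ.* a) * ½      ∎
  where open ≡-Reasoning

1+k/2≡[2+k]*½ : ∀ k → 1ℚ + + k / 2 ≡ fromℕ (2 ℕ.+ k) * ½
1+k/2≡[2+k]*½ k = begin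
  -- By computation `1ℚ` is `fromℕ 2 * ½`, and `fromℕ k * ½` unfolds to a quotient by `2` whose
  -- numerator is `+ k` times one.
  1ℚ + + k / 2             ≡⟨ cong (λ i → 1ℚ + i / 2) (ℤₚ.*-identityʳ (+ k)) ⟨
  fromℕ 2 * ½ + fromℕ k * ½ ≡⟨ ℚₚ.*-distribʳ-+ ½ (fromℕ 2) (fromℕ k) ⟨
  (fromℕ 2 + fromℕ k) * ½  ≡⟨ cong (_* ½) (fromℕ-homo-+ 2 k) ⟨
  fromℕ (2 ℕ.+ k) * ½      ∎
  where open ≡-Reasoning

fromℕ*[1+k/2] : ∀ a k → fromℕ a * (1ℚ + + k / 2) ≡ fromℕ (a ℕ.* (2 ℕ.+ k)) * ½
fromℕ*[1+k/2] a k = begin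
  fromℕ a * (1ℚ + + k / 2)            ≡⟨ cong (fromℕ a *_) (1+k/2≡[2+k]*½ k) ⟩
  fromℕ a * (fromℕ (2 ℕ.+ k) * ½)     ≡⟨ ℚₚ.*-assoc (fromℕ a) (fromℕ (2 ℕ.+ k)) ½ ⟨
  fromℕ a * fromℕ (2 ℕ.+ k) * ½       ≡⟨ cong (_* ½) (fromℕ-homo-* a (2 ℕ.+ k)) ⟨
  fromℕ (a ℕ.* (2 ℕ.+ k)) * ½         ∎
  where open ≡-Reasoning

upperBound-halve : ∀ n k → fromℕ n * (1ℚ + + k / 2) + fromℕ 2 * (fromℕ k * fromℕ k) ≡
                           fromℕ (n ℕ.* (2 ℕ.+ k) ℕ.+ 2 ℕ.* (2 ℕ.* (k ℕ.* k))) * ½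
upperBound-halve n k = begin
  fromℕ n * (1ℚ + + k / 2) + fromℕ 2 * (fromℕ k * fromℕ k)
    ≡⟨ cong₂ _+_ (fromℕ*[1+k/2] n k) (cong (fromℕ 2 *_) (sym (fromℕ-homo-* k k))) ⟩
  fromℕ (n ℕ.* (2 ℕ.+ k)) * ½ + fromℕ 2 * fromℕ (k ℕ.* k)
    ≡⟨ cong (λ x → fromℕ (n ℕ.* (2 ℕ.+ k)) * ½ + x) (trans (sym (fromℕ-homo-* 2 (k ℕ.* k))) (fromℕ-halve (2 ℕ.* (k ℕ.* k)))) ⟩
  fromℕ (n ℕ.* (2 ℕ.+ k)) * ½ + fromℕ (2 ℕ.* (2 ℕ.* (k ℕ.* k))) * ½
    ≡⟨ ℚₚ.*-distribʳ-+ ½ (fromℕ (n ℕ.* (2 ℕ.+ k))) (fromℕ (2 ℕ.* (2 ℕ.* (k ℕ.* k)))) ⟨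
  (fromℕ (n ℕ.* (2 ℕ.+ k)) + fromℕ (2 ℕ.* (2 ℕ.* (k ℕ.* k)))) * ½
    ≡⟨ cong (_* ½) (fromℕ-homo-+ (n ℕ.* (2 ℕ.+ k)) (2 ℕ.* (2 ℕ.* (k ℕ.* k)))) ⟨
  fromℕ (n ℕ.* (2 ℕ.+ k) ℕ.+ 2 ℕ.* (2 ℕ.* (k ℕ.* k))) * ½ ∎
  where open ≡-Reasoning

halve-mono-≤ : ∀ {a b} → a ℕ.≤ b → fromℕ a * ½ ≤ fromℕ b * ½
halve-mono-≤ a≤b = ℚₚ.*-monoʳ-≤-nonNeg ½ (fromℕ-mono-≤ a≤b)

theorem2p5 : ∃[ C ] 0ℚ < C ×
    (∀ (k n : ℕ) → 1 ℕ.≤ k → k ℕ.+ 2 ℕ.≤ n →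
    ∃[ m ] IsM n k m
    × (fromℕ n - 1ℚ) * (1ℚ + + k / 2) ≤ fromℕ m
    × fromℕ m ≤ fromℕ n * (1ℚ + + k / 2) + C * (fromℕ k * fromℕ k)
    × (n % suc k ≡ 1 % suc k →
    fromℕ m ≡ (fromℕ n - 1ℚ) * (1ℚ + + k / 2)))
-- `C` is `2`, half of the constant in the error term `4 k * k` of the doubled bound.
theorem2p5 = fromℕ 2 , *<* (ℤ.+<+ (s≤s z≤n)) , bounds
  where
  bounds : ∀ (k n : ℕ) → 1 ℕ.≤ k → k ℕ.+ 2 ℕ.≤ n →
    ∃[ m ] IsM n k m
    × (fromℕ n - 1ℚ) * (1ℚ + + k / 2) ≤ fromℕ m
    × fromℕ m ≤ fromℕ n * (1ℚ + + k / 2) + fromℕ 2 * (fromℕ k * fromℕ k)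
    × (n % suc k ≡ 1 % suc k →
       fromℕ m ≡ (fromℕ n - 1ℚ) * (1ℚ + + k / 2))
  bounds k zero    _   k+2≤0 = contradiction (ℕₚ.m+n≤o⇒n≤o k k+2≤0) λ ()
  bounds k (suc N) 1≤k k+2≤n =
    let m , isM , lower , upper , exact = M-bounds k N 1≤k k+2≤n
    in m , isM ,
       subst₂ _≤_ (sym N*[1+k/2]) (sym (fromℕ-halve m)) (halve-mono-≤ lower) ,
       subst₂ _≤_ (sym (fromℕ-halve m)) (sym (upperBound-halve (suc N) k)) (halve-mono-≤ upper) ,
       λ n%≡1 → trans (fromℕ-halve m) (trans (cong (λ a → fromℕ a * ½) (exact n%≡1)) (sym N*[1+k/2]))
    where
    N*[1+k/2] : (fromℕ (suc N) - 1ℚ) * (1ℚ + + k / 2) ≡ fromℕ (N ℕ.* (2 ℕ.+ k)) * ½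
    N*[1+k/2] = trans (cong (_* (1ℚ + + k / 2)) (fromℕ-pred N)) (fromℕ*[1+k/2] N k)
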